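{- Let $Q=T[H_1,\dots,H_t]$ be a strong semicomplete composition. If $T$ has a strict 3-king and every 2-king of $T$ is dominated by some strict 3-king of $T$, then $Q$ can be established, i.e. there exists a semicomplete composition $Q'$ containing $Q$ as an induced subdigraph such that the set of all 3-kings of $Q'$ is exactly $V(Q)$.
   Context: All digraphs are finite, without loops or parallel arcs; paths are directed; $d_D(x,y)$ is the length of a shortest directed $x$–$y$ path. Let $T$ be a digraph with vertices $u_1,\dots,u_t$ ($t\ge 2$) and $H_1,\dots,H_t$ digraphs, $H_i$ having vertices $u_{i,j}$, $1\le j\le n_i$. The composition $Q=T[H_1,\dots,H_t]$ has vertex set $\{u_{i,j}\}$ and arc set $\bigcup_i A(H_i)\cup\{u_{i,j}u_{p,q}: u_iu_p\in A(T)\}$ (all $j,q$). It is a semicomplete composition if $T$ is semicomplete (at least one arc between every two distinct vertices). A digraph is strong if every vertex can reach every other vertex. For $k\ge2$, a $k$-king of $D$ is a vertex from which every other vertex can be reached by a directed path of length at most $k$; a $k$-king $u$ is strict if there is a vertex $v$ with $d_D(u,v)=k$. A vertex $x$ dominates $y$ if $xy$ is an arc. -}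

module Defs where

open import Data.Nat using (ℕ; zero; suc; _≤_; _∸_)
open import Data.Fin using (Fin)
open import Data.Product using (Σ; ∃; ∃-syntax; _×_; _,_)
open import Data.Sum using (_⊎_)
open import Relation.Nullary using (¬_)
open import Relation.Binary.PropositionalEquality using (_≡_; _≢_)

-- A (finite, when V is finite) digraph: an arc relation without loops.
-- Being a relation, there are no parallel arcs.
record Digraph (V : Set) : Set₁ where
  field
    Arc      : V → V → Set
    loopless : ∀ x → ¬ Arc x x
open Digraph public

module _ {V : Set} (D : Digraph V) where

  data Walk : ℕ → V → V → Set where
    [] : ∀ {x} → Walk zero x x
    _∷_ : ∀ {ℓ x y z} → Arc D x y → Walk ℓ y z → Walk (suc ℓ) x z

  DistLe : ℕ → V → V → Set
  DistLe k x y = ∃[ ℓ ] (ℓ ≤ k × Walk ℓ x y)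

  -- d_D(x,y) = k  (for k ≥ 1)
  DistEq : ℕ → V → V → Set
  DistEq k x y = DistLe k x y × ¬ DistLe (k ∸ 1) x y

  Strong : Set
  Strong = ∀ x y → ∃[ ℓ ] Walk ℓ x y

  Semicomplete : Set
  Semicomplete = ∀ x y → x ≢ y → Arc D x y ⊎ Arc D y x

  IsKing : ℕ → V → Set
  IsKing k u = ∀ v → v ≢ u → DistLe k u v

  IsStrictKing : ℕ → V → Set
  IsStrictKing k u = IsKing k u × ∃[ v ] DistEq k u v

module _ {t : ℕ} (T : Digraph (Fin t)) (n : Fin t → ℕ)
         (H : (i : Fin t) → Digraph (Fin (n i))) where

  CVertex : Set
  CVertex = Σ (Fin t) (λ i → Fin (n i))

  data CompArc : CVertex → CVertex → Set where
    inner : ∀ {i j q} → Arc (H i) j q → CompArc (i , j) (i , q)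
    outer : ∀ {i p j q} → Arc T i p → CompArc (i , j) (p , q)

  compLoopless : ∀ x → ¬ CompArc x x
  compLoopless (i , j) (inner a) = loopless (H i) j a
  compLoopless (i , j) (outer a) = loopless T i a

  Comp : Digraph CVertex
  Comp = record { Arc = CompArc ; loopless = compLoopless }

IsInducedEmbedding : ∀ {V W : Set} → Digraph V → Digraph W → (V → W) → Set
IsInducedEmbedding D D' f =
  (∀ x y → f x ≡ f y → x ≡ y) ×
  (∀ x y → (Arc D x y → Arc D' (f x) (f y)) × (Arc D' (f x) (f y) → Arc D x y))

{-# OPTIONS --safe #-}
module Submission where

-- Call z far from s when d(s,z) > 2; then z dominates s and every out-neighbour
-- of s.  If u is not a 2-king, a 2-king q of the subdigraph of vertices far from u
-- is a 2-king of T.  A strict 3-king w dominating q cannot be u or an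
-- out-neighbour of u, so w dominates u.  Hence every vertex is dominated by a
-- strict 3-king.  If z is far from w and z is itself one of the chosen dominators,
-- z dominates everything that w dominates, so w can be discarded; we are left with
-- dominators wᵢ, with zᵢ far from wᵢ, such that no zᵢ is a wⱼ.
-- Add new vertices yᵢ dominated by all of T, with yᵢ → wᵢ as the only arc back,
-- and yᵢ → yⱼ unless wⱼ → zᵢ; both wⱼ → zᵢ and wᵢ → zⱼ cannot happen, as one of
-- zᵢ, zⱼ equals or dominates the other.  Then x → yᵢ → wᵢ → y connects any two old vertices,
-- while yᵢ is at distance at least 4 from zᵢ.
-- Arcs are not decidable, so the 2-king argument runs on lists of vertices whose
-- known arcs come from semicompleteness alone.

open import Defs
open import Data.Empty using (⊥; ⊥-elim)
open import Data.Fin using (Fin; _≟_; splitAt; join; punchIn; punchOut; fromℕ<; _↑ˡ_)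
open import Data.Fin.Properties
  using (any?; punchIn-punchOut; splitAt-↑ˡ; splitAt-join; join-splitAt; splitAt⁻¹-↑ˡ)
open import Data.List using (List; []; _∷_; length; filter; allFin)
open import Data.List.Membership.Propositional using (_∈_; find; lose)
open import Data.List.Membership.Propositional.Properties using (∈-allFin; ∈-filter⁺)
open import Data.List.Properties using (filter-notAll)
open import Data.List.Relation.Unary.All using (All; []; _∷_; lookup)
import Data.List.Relation.Unary.All as All
open import Data.List.Relation.Unary.All.Properties using (filter⁺)
open import Data.List.Relation.Unary.Any using (Any; here; there)
open import Data.Nat using (ℕ; suc; _+_; _≤_; _<_; z≤n; s≤s)
open import Data.Nat.Induction using (<-wellFounded)
open import Data.Nat.Properties using (≤-refl; ≤-trans; m≤m+n; m≤n⇒m≤1+n)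
open import Data.Product using (Σ; ∃-syntax; _×_; _,_; proj₁; proj₂)
open import Data.Sum using (_⊎_; inj₁; inj₂; [_,_]′)
open import Data.Unit using (⊤; tt)
open import Induction.WellFounded using (Acc; acc)
open import Relation.Nullary using (¬_; yes; no; ¬?)
open import Relation.Binary.PropositionalEquality
  using (_≡_; _≢_; refl; sym; trans; cong; subst; subst₂; subst-sym-subst)

module _ {V : Set} {D : Digraph V} where

  distLe-refl : ∀ {k x} → DistLe D k x x
  distLe-refl = 0 , z≤n , []

  arc⇒distLe : ∀ {k x y} → Arc D x y → DistLe D (suc k) x y
  arc⇒distLe e = 1 , s≤s z≤n , e ∷ []

  arcs⇒distLe : ∀ {k x y z} → Arc D x y → Arc D y z → DistLe D (suc (suc k)) x z
  arcs⇒distLe e e′ = 2 , s≤s (s≤s z≤n) , e ∷ e′ ∷ []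

-- This replaces filtering by an undecidable property: `P` and `Q` may overlap, and `d` picks the
-- side.
separate : ∀ {A : Set} {P Q : A → Set} → (∀ x → P x ⊎ Q x) → (xs : List A) →
  ∃[ ys ] (All Q ys × (∀ {x} → x ∈ xs → P x ⊎ x ∈ ys))
separate d [] = [] , [] , λ ()
separate d (x ∷ xs) with d x | separate d xs
... | inj₁ p | ys , qs , c = ys , qs , λ { (here refl) → inj₁ p ; (there i) → c i }
... | inj₂ q | ys , qs , c = x ∷ ys , q ∷ qs ,
  λ { (here refl) → inj₂ (here refl) ; (there i) → [ inj₁ , (λ j → inj₂ (there j)) ]′ (c i) }

-- Two-kings and dominating strict 3-kings

module SemicompleteDigraph {t : ℕ} (T : Digraph (Fin t)) (sc : Semicomplete T) where

  private V = Fin t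

  -- `C` is a list of possible midpoints: `ReachesAll x C` and `Covers C p` together certify
  -- distance at most 2 from `x` to `p`.
  ReachesAll : V → List V → Set
  ReachesAll x = All (λ c → x ≡ c ⊎ Arc T x c)

  Covers : List V → V → Set
  Covers C p = Any (λ c → c ≡ p ⊎ Arc T c p) C

  compare : ∀ x y → Arc T x y ⊎ (y ≡ x ⊎ Arc T y x)
  compare x y with x ≟ y
  ... | yes x≡y = inj₂ (inj₁ (sym x≡y))
  ... | no x≢y = [ inj₁ , (λ e → inj₂ (inj₂ e)) ]′ (sc x y x≢y)

  covers-or-dominated : ∀ C x → Covers C x ⊎ All (Arc T x) C
  covers-or-dominated [] x = inj₂ []
  covers-or-dominated (c ∷ C) x with compare x c | covers-or-dominated C x
  ... | inj₂ r | _      = inj₁ (here r)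
  ... | inj₁ _ | inj₁ r = inj₁ (there r)
  ... | inj₁ e | inj₂ es = inj₂ (e ∷ es)

  reach-covered : ∀ {x C p} → ReachesAll x C → Covers C p → DistLe T 2 x p
  reach-covered rs cov with find cov
  ... | c , c∈C , r with lookup rs c∈C | r
  ... | inj₁ refl | inj₁ refl = distLe-refl
  ... | inj₁ refl | inj₂ e    = arc⇒distLe e
  ... | inj₂ e    | inj₁ refl = arc⇒distLe e
  ... | inj₂ e    | inj₂ e′   = arcs⇒distLe e e′

  -- Induction on the list: the old king `q` survives if `C` covers `x`; otherwise `x` dominates all
  -- of `C` and takes over, with `x ∷ C` as midpoints.
  list-king : ∀ x xs →
    ∃[ q ] (q ∈ x ∷ xs × ∃[ C ] (ReachesAll q C × All (Covers C) (x ∷ xs)))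
  list-king x [] =
    x , here refl , x ∷ [] , inj₁ refl ∷ [] , here (inj₁ refl) ∷ []
  list-king x (y ∷ ys) with list-king y ys
  ... | q , q∈ , C , rs , cs with covers-or-dominated C x
  ... | inj₁ c  = q , there q∈ , C , rs , c ∷ cs
  ... | inj₂ es = x , here refl , x ∷ C , inj₁ refl ∷ All.map inj₂ es ,
                  here (inj₁ refl) ∷ All.map there cs

  module _ (dominated : ∀ u → IsKing T 2 u → ∃[ w ] (IsStrictKing T 3 w × Arc T w u)) where

    -- L lists the vertices not yet known to be within distance 2 of u; each round
    -- either finds a strict 3-king dominating u or shows that some q in L is
    -- within distance 2 of u after all.
    dominated-by-search : ∀ u C → ReachesAll u C → (∀ w → Arc T w u ⊎ w ∈ C) →
      ∀ L → Acc _<_ (length L) → All (λ x → All (Arc T x) C) L →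
      (∀ p → Covers C p ⊎ p ∈ L) →
      ∃[ w ] (IsStrictKing T 3 w × Arc T w u)
    dominated-by-search u C rs out [] _ _ cov =
      dominated u λ p _ → [ reach-covered rs , (λ ()) ]′ (cov p)
    dominated-by-search u C rs out L@(x ∷ xs) (acc smaller) doms cov
      with list-king x xs
    ... | q , q∈L , C′ , rs′ , cs′ with dominated q q-king
      where
      q-king : IsKing T 2 q
      -- `q` dominates every vertex of `C`, hence is within 2 of all that `C` covers; what remains
      -- lies in `L`, where `q` is a king.
      q-king p _ =
        [ reach-covered (All.map inj₂ (lookup doms q∈L))
        , (λ p∈L → reach-covered rs′ (lookup cs′ p∈L)) ]′ (cov p)
    ... | w , w-king , w→q with out w
    ... | inj₁ w→u = w , w-king , w→u
    ... | inj₂ w∈C =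
      dominated-by-search u C rs out (filter ≢q? L)
        (smaller (filter-notAll ≢q? L (lose q∈L λ q≢q → q≢q refl)))
        (filter⁺ ≢q? doms) cov′
      where
      ≢q? = λ p → ¬? (p ≟ q)
      cov′ : ∀ p → Covers C p ⊎ p ∈ filter ≢q? L
      cov′ p with p ≟ q | cov p
      ... | yes refl | _        = inj₁ (lose w∈C (inj₂ w→q))
      ... | no _     | inj₁ c   = inj₁ c
      ... | no p≢q   | inj₂ p∈L = inj₂ (∈-filter⁺ ≢q? p∈L p≢q)

    dominated-by-strict-king : ∀ u → ∃[ w ] (IsStrictKing T 3 w × Arc T w u)
    -- `C` gets `u` and out-neighbours of `u`, `L` the vertices for which the comparison yields arcs
    -- to all of `C`.
    dominated-by-strict-king u
      with separate (λ w → compare w u) (allFin t)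
    ... | C , rs , out with separate (covers-or-dominated C) (allFin t)
    ... | L , doms , cov =
      dominated-by-search u C rs (λ w → out (∈-allFin w)) L (<-wellFounded _) doms
        (λ p → cov (∈-allFin p))

  -- Pruning the dominators

  record Dominators (m : ℕ) : Set where
    field
      w z   : Fin m → V
      far   : ∀ i → ¬ DistLe T 2 (w i) (z i)
      cover : ∀ u → ∃[ i ] Arc T (w i) u

  open Dominators

  -- If zᵢ were wⱼ, the new vertex yⱼ would dominate zᵢ and give a short walk from yᵢ.
  Separated : ∀ {m} → Dominators m → Set
  Separated S = ∀ i j → z S i ≢ w S j

  separated-dominators : ∀ {m} → Dominators m → ∃[ m′ ] Σ (Dominators m′) Separated
  separated-dominators {m} S with any? (λ i → any? (λ j → z S i ≟ w S j))
  ... | no none = m , S , λ i j z≡w → none (i , j , z≡w)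
  -- Dropping index `i` lowers the size, so the recursion ends; vertices covered by wᵢ pass to wⱼ.
  separated-dominators {suc m} S | yes (i , j , zᵢ≡wⱼ) = separated-dominators record
    { w     = λ k → w S (punchIn i k)
    ; z     = λ k → z S (punchIn i k)
    ; far   = λ k → far S (punchIn i k)
    ; cover = cover′
    }
    where
    i≢j : i ≢ j
    i≢j refl = far S i (subst (DistLe T 2 (w S i)) (sym zᵢ≡wⱼ) distLe-refl)

    restrict : ∀ {u} k → i ≢ k → Arc T (w S k) u → ∃[ l ] Arc T (w S (punchIn i l)) u
    restrict k i≢k e =
      punchOut i≢k , subst (λ l → Arc T (w S l) _) (sym (punchIn-punchOut i≢k)) e

    takeover : ∀ u → Arc T (w S i) u → Arc T (w S j) u
    takeover u wᵢ→u with compare (w S j) u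
    ... | inj₁ wⱼ→u = wⱼ→u
    ... | inj₂ r = ⊥-elim (far S i (subst (DistLe T 2 (w S i)) (sym zᵢ≡wⱼ) (short r)))
      where
      short : u ≡ w S j ⊎ Arc T u (w S j) → DistLe T 2 (w S i) (w S j)
      short (inj₁ refl) = arc⇒distLe wᵢ→u
      short (inj₂ u→wⱼ) = arcs⇒distLe wᵢ→u u→wⱼ

    cover′ : ∀ u → ∃[ l ] Arc T (w S (punchIn i l)) u
    cover′ u with cover S u
    ... | k , e with i ≟ k
    ... | yes refl = restrict j i≢j (takeover u e)
    ... | no i≢k   = restrict k i≢k e

  -- Extending the semicomplete digraph

  module Extension {m : ℕ} (S : Dominators m) (separated : Separated S) where

    ExtArc : V ⊎ Fin m → V ⊎ Fin m → Set
    ExtArc (inj₁ x) (inj₁ y) = Arc T x y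
    ExtArc (inj₁ x) (inj₂ i) = ⊤
    ExtArc (inj₂ i) (inj₁ x) = x ≡ w S i
    ExtArc (inj₂ i) (inj₂ j) = i ≢ j × ¬ Arc T (w S j) (z S i)

    Ext : Digraph (V ⊎ Fin m)
    Ext .Arc = ExtArc
    Ext .loopless (inj₁ x) = loopless T x
    Ext .loopless (inj₂ i) (i≢i , _) = i≢i refl

    ext-semicomplete : Semicomplete Ext
    ext-semicomplete (inj₁ x) (inj₁ y) x≢y = sc x y λ { refl → x≢y refl }
    ext-semicomplete (inj₁ x) (inj₂ i) _ = inj₁ tt
    ext-semicomplete (inj₂ i) (inj₁ x) _ = inj₂ tt
    -- Comparing zᵢ with zⱼ proves one of the two negations without deciding any arc: if zᵢ equals
    -- or dominates zⱼ, then wⱼ → zᵢ would put zⱼ within 2 of wⱼ.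
    ext-semicomplete (inj₂ i) (inj₂ j) i≢j with compare (z S i) (z S j)
    ... | inj₁ zᵢ→zⱼ =
      inj₁ ((λ { refl → i≢j refl }) , λ e → far S j (arcs⇒distLe e zᵢ→zⱼ))
    ... | inj₂ (inj₁ zⱼ≡zᵢ) =
      inj₁ ((λ { refl → i≢j refl }) ,
            λ e → far S j (subst (DistLe T 2 (w S j)) (sym zⱼ≡zᵢ) (arc⇒distLe e)))
    ... | inj₂ (inj₂ zⱼ→zᵢ) =
      inj₂ ((λ { refl → i≢j refl }) , λ e → far S i (arcs⇒distLe e zⱼ→zᵢ))

    -- Positive length matters even for `b` equal to `inj₁ x`: it must connect distinct vertices of
    -- one part of the composition.
    walk-from-old : ∀ x b → ∃[ ℓ ] (suc ℓ ≤ 3 × Walk Ext (suc ℓ) (inj₁ x) b)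
    walk-from-old x (inj₂ i) = 0 , s≤s z≤n , tt ∷ []
    walk-from-old x (inj₁ y) with cover S y
    ... | i , e = 2 , ≤-refl , _∷_ {y = inj₂ i} tt (_∷_ {y = inj₁ (w S i)} refl (e ∷ []))

    -- The last arc cannot leave a new vertex, by `separated`. Otherwise the walk runs from wᵢ to zᵢ
    -- in at most two arcs, against `far`, or is yᵢ → yⱼ → wⱼ → zᵢ, which the rule for arcs between
    -- new vertices forbids.
    ext-far : ∀ i → ¬ DistLe Ext 3 (inj₂ i) (inj₁ (z S i))
    ext-far i (1 , _ , (e ∷ [])) = separated i i e
    ext-far i (2 , _ , (_∷_ {y = inj₁ _} refl (e ∷ []))) = far S i (arc⇒distLe e)
    ext-far i (2 , _ , (_∷_ {y = inj₂ j} _ (e ∷ []))) = separated i j e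
    ext-far i (3 , _ , (_∷_ {y = inj₁ _} refl (_∷_ {y = inj₁ _} e (e′ ∷ [])))) =
      far S i (arcs⇒distLe e e′)
    ext-far i (3 , _ , (_∷_ {y = inj₁ _} refl (_∷_ {y = inj₂ j} _ (e ∷ [])))) =
      separated i j e
    ext-far i (3 , _ , (_∷_ {y = inj₂ j} (_ , ¬e) (_∷_ {y = inj₁ _} refl (e ∷ [])))) = ¬e e
    ext-far i (3 , _ , (_∷_ {y = inj₂ _} _ (_∷_ {y = inj₂ k} _ (e ∷ [])))) =
      separated i k e
    ext-far i (suc (suc (suc (suc _))) , s≤s (s≤s (s≤s ())) , _)

    -- Passing to the compositions

    module Composition (n : V → ℕ) (n≥1 : ∀ i → 1 ≤ n i) (H : ∀ i → Digraph (Fin (n i))) where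

      side : Fin (t + m) → V ⊎ Fin m
      side = splitAt t

      size : V ⊎ Fin m → ℕ
      size (inj₁ i) = n i
      size (inj₂ _) = 1

      part : ∀ s → Digraph (Fin (size s))
      part (inj₁ i) = H i
      part (inj₂ _) = record { Arc = λ _ _ → ⊥ ; loopless = λ _ () }

      T′ : Digraph (Fin (t + m))
      T′ .Arc k l = ExtArc (side k) (side l)
      T′ .loopless k = loopless Ext (side k)

      n′ : Fin (t + m) → ℕ
      n′ k = size (side k)

      H′ : ∀ k → Digraph (Fin (n′ k))
      H′ k = part (side k)

      Q  = Comp T n H
      Q′ = Comp T′ n′ H′
      VQ  = CVertex T n H
      VQ′ = CVertex T′ n′ H′

      T′-semicomplete : Semicomplete T′
      T′-semicomplete k l k≢l =
        ext-semicomplete (side k) (side l) λ eq → k≢l (splitAt-injective eq)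
        where
        splitAt-injective : side k ≡ side l → k ≡ l
        splitAt-injective eq =
          trans (sym (join-splitAt t m k)) (trans (cong (join t m) eq) (join-splitAt t m l))

      size≥1 : ∀ s → 1 ≤ size s
      size≥1 (inj₁ i) = n≥1 i
      size≥1 (inj₂ _) = s≤s z≤n

      -- Lifted walks need an actual vertex in every part they visit, so parts must be nonempty.
      representative : ∀ s → ∃[ v ] (side (proj₁ {B = λ k → Fin (n′ k)} v) ≡ s)
      representative s =
        (join t m s , fromℕ< (size≥1 (side (join t m s)))) , splitAt-join t m s

      -- Indexing by `side k` instead of `k` describes embedded vertices without transport.
      Located : Set
      Located = Σ (V ⊎ Fin m) (λ s → Fin (size s))

      located : VQ′ → Located
      located (k , j) = side k , j

      embed : VQ → VQ′
      embed (i , j) = i ↑ˡ m , subst (λ s → Fin (size s)) (sym (splitAt-↑ˡ t i m)) j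

      located-embed : ∀ x → located (embed x) ≡ (inj₁ (proj₁ x) , proj₂ x)
      located-embed (i , j) = lemma (splitAt-↑ˡ t i m)
        where
        lemma : ∀ {s} (eq : s ≡ inj₁ i) →
          _≡_ {A = Located}
            (s , subst (λ s → Fin (size s)) (sym eq) j) (inj₁ i , j)
        lemma refl = refl

      in-image : ∀ {i k} q → i ↑ˡ m ≡ k → ∃[ x ] embed x ≡ (k , q)
      in-image {i} q refl =
        (i , subst (λ s → Fin (size s)) (splitAt-↑ˡ t i m) q) ,
        cong (i ↑ˡ m ,_) (subst-sym-subst (splitAt-↑ˡ t i m))

      embed-injective : ∀ x y → embed x ≡ embed y → x ≡ y
      embed-injective x y eq
        with trans (sym (located-embed x)) (trans (cong located eq) (located-embed y))
      ... | refl = refl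

      arc⁺ : ∀ {x y} → Arc Q x y → Arc Q′ (embed x) (embed y)
      arc⁺ {i , _} (inner e) = inner (within (splitAt-↑ˡ t i m) e)
        where
        within : ∀ {s j q} (eq : s ≡ inj₁ i) → Arc (H i) j q →
          Arc (part s) (subst (λ s → Fin (size s)) (sym eq) j)
                       (subst (λ s → Fin (size s)) (sym eq) q)
        within refl e = e
      arc⁺ {i , _} {p , _} (outer e) =
        outer (subst₂ ExtArc (sym (splitAt-↑ˡ t i m)) (sym (splitAt-↑ˡ t p m)) e)

      -- The endpoints `a` and `b` are kept general so that the arc can be matched on.
      arc⁻ : ∀ {x y a b} → located a ≡ (inj₁ (proj₁ x) , proj₂ x) →
        located b ≡ (inj₁ (proj₁ y) , proj₂ y) → Arc Q′ a b → Arc Q x y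
      arc⁻ eq eq′ (outer e) = outer (subst₂ ExtArc (cong proj₁ eq) (cong proj₁ eq′) e)
      arc⁻ {a = k , _} eq eq′ (inner e) = within (side k) e eq eq′
        where
        within : ∀ s {j q} → Arc (part s) j q → ∀ {x y} →
          _≡_ {A = Located} (s , j) (inj₁ (proj₁ x) , proj₂ x) →
          _≡_ {A = Located} (s , q) (inj₁ (proj₁ y) , proj₂ y) → Arc Q x y
        within _ e refl refl = inner e

      -- Arcs inside a part collapse, so the length survives only as a bound.
      project : ∀ {ℓ a b} → Walk Q′ ℓ a b → DistLe Ext ℓ (side (proj₁ a)) (side (proj₁ b))
      project [] = distLe-refl
      project (inner _ ∷ p) with project p
      ... | ℓ , ℓ≤ , q = ℓ , m≤n⇒m≤1+n ℓ≤ , q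
      project (outer e ∷ p) with project p
      ... | ℓ , ℓ≤ , q = suc ℓ , s≤s ℓ≤ , e ∷ q

      -- Each arc joins all vertices of its two parts, so both ends can be prescribed freely once
      -- there is at least one arc.
      lift : ∀ {ℓ s s′} → Walk Ext (suc ℓ) s s′ → ∀ a b →
        side (proj₁ a) ≡ s → side (proj₁ b) ≡ s′ → Walk Q′ (suc ℓ) a b
      lift (e ∷ []) a b refl refl = outer e ∷ []
      lift (_∷_ {y = s} e p@(_ ∷ _)) a b refl eq with representative s
      ... | c , refl = outer e ∷ lift p c b refl eq

      new-not-king : ∀ v {i} → side (proj₁ v) ≡ inj₂ i → ¬ IsKing Q′ 3 v
      new-not-king v {i} side-v king with representative (inj₁ (z S i))
      ... | c , side-c with king c c≢v
        where
        c≢v : c ≢ v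
        c≢v refl with trans (sym side-c) side-v
        ... | ()
      ... | ℓ , ℓ≤3 , p with project p
      ... | ℓ′ , ℓ′≤ℓ , p′ =
        ext-far i (ℓ′ , ≤-trans ℓ′≤ℓ ℓ≤3 , subst₂ (Walk Ext ℓ′) side-v side-c p′)

      king⇒old : ∀ v → IsKing Q′ 3 v → ∃[ x ] embed x ≡ v
      king⇒old v@(k , q) king = classify (side k) refl
        where
        classify : ∀ s → side k ≡ s → ∃[ x ] embed x ≡ v
        classify (inj₁ i) eq = in-image q (splitAt⁻¹-↑ˡ eq)
        classify (inj₂ i) eq = ⊥-elim (new-not-king v eq king)

      old⇒king : ∀ v → ∃[ x ] embed x ≡ v → IsKing Q′ 3 v
      old⇒king _ ((i , j) , refl) c _ with walk-from-old i (side (proj₁ c))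
      ... | ℓ , ℓ<3 , p = suc ℓ , ℓ<3 , lift p _ c (splitAt-↑ˡ t i m) refl

theorem2p10 : (t : ℕ) → 2 ≤ t → (T : Digraph (Fin t)) → Semicomplete T →
    (n : Fin t → ℕ) → (∀ i → 1 ≤ n i) → (H : (i : Fin t) → Digraph (Fin (n i))) →
    Strong (Comp T n H) →
    (∃[ u ] IsStrictKing T 3 u) →
    (∀ u → IsKing T 2 u → ∃[ w ] (IsStrictKing T 3 w × Arc T w u)) →
    ∃[ t' ] Σ (2 ≤ t') λ _ → Σ (Digraph (Fin t')) λ T' → Σ (Semicomplete T') λ _ →
    Σ (Fin t' → ℕ) λ n' → Σ (∀ i → 1 ≤ n' i) λ _ →
    Σ ((i : Fin t') → Digraph (Fin (n' i))) λ H' →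
    Σ (CVertex T n H → CVertex T' n' H') λ f →
    IsInducedEmbedding (Comp T n H) (Comp T' n' H') f ×
    (∀ v → (IsKing (Comp T' n' H') 3 v → ∃[ x ] f x ≡ v) ×
    ((∃[ x ] f x ≡ v) → IsKing (Comp T' n' H') 3 v))
theorem2p10 t 2≤t T sc n n≥1 H _ _ dominated =
  t + proj₁ pruned , ≤-trans 2≤t (m≤m+n t _) , T′ , T′-semicomplete , n′ ,
  (λ k → size≥1 (side k)) , H′ , embed ,
  (embed-injective , λ x y → arc⁺ , arc⁻ (located-embed x) (located-embed y)) ,
  λ v → king⇒old v , old⇒king v
  where
  open SemicompleteDigraph T sc
  king : ∀ u → ∃[ w ] (IsStrictKing T 3 w × Arc T w u)
  king = dominated-by-strict-king dominated
  pruned : ∃[ m ] Σ (Dominators m) Separated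
  -- Initially every vertex `u` indexes its own dominator; `z` is the vertex at distance exactly 3
  -- that makes it strict, and `3 ∸ 1` computes to the 2 in `far`.
  pruned = separated-dominators record
    { w     = λ u → proj₁ (king u)
    ; z     = λ u → proj₁ (proj₂ (proj₁ (proj₂ (king u))))
    ; far   = λ u → proj₂ (proj₂ (proj₂ (proj₁ (proj₂ (king u)))))
    ; cover = λ u → u , proj₂ (proj₂ (king u))
    }
  open Extension (proj₁ (proj₂ pruned)) (proj₂ (proj₂ pruned))
  open Composition n n≥1 H
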